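{- Let $t\geq 2$ be an integer and let $A$ be a column-$t$-partite zero-one matrix. Then $\operatorname{ex}(n,A)=O(n^{2-\frac{1}{t}})$ as $n\to\infty$, where the implied constant may depend on $t$ and $A$ but not on $n$.
   Context: A zero-one matrix is a (finite) matrix all of whose entries are $0$ or $1$. For zero-one matrices $A$ and $M$, we say that $M$ contains $A$ if, by deleting some (possibly no) rows and columns from $M$, and possibly turning some of its $1$-entries into $0$-entries, we can obtain $A$ (the order of the remaining rows and columns is kept). The weight of a zero-one matrix is the number of its $1$-entries. The extremal number $\operatorname{ex}(n,A)$ of a zero-one matrix $A$ is the maximum possible weight of an $n\times n$ zero-one matrix that does not contain $A$. A zero-one matrix $A$ is column-$t$-partite if it can be cut along its columns (i.e. by vertical cuts, so that each piece consists of consecutive columns of $A$ with all rows kept) into $t$ submatrices such that every row of each of these submatrices contains at most one $1$-entry. -}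

module Defs where

open import Data.Bool using (Bool; true; false)
import Data.Bool.Properties as Bool
open import Data.Fin using (Fin; _<_; _≤_)
open import Data.Fin.Properties using (_<?_; all?)
open import Data.List using (List; []; _∷_; map; filter; allFin; cartesianProductWith)
open import Data.List.Extrema.Nat using (max; argmax-sel; xs≤max)
open import Data.List.Membership.Propositional using (_∈_; lose)
open import Data.List.Membership.Propositional.Properties
  using (∈-allFin; ∈-cartesianProductWith⁺; ∈-filter⁺; ∈-filter⁻; ∈-map⁺; ∈-map⁻)
import Data.List.Relation.Unary.All as All
open import Data.List.Relation.Unary.Any using (any?; satisfied; here; there)
open import Data.Nat as ℕ using (ℕ; zero; suc; _*_; _^_; z≤n)
import Data.Nat.Properties as ℕ
open import Data.Product using (Σ-syntax; ∃-syntax; _×_; _,_; proj₂)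
open import Data.Sum using (inj₁; inj₂)
open import Data.Vec as Vec using (Vec; []; _∷_; lookup)
open import Function using (id)
open import Relation.Binary using (_Preserves_⟶_)
open import Relation.Binary.PropositionalEquality using (_≡_; refl; sym; trans; subst)
open import Relation.Nullary using (Dec; ¬_; ¬?)
open import Relation.Nullary.Decidable using (map′; _×-dec_; _→-dec_)
open import Relation.Unary using (Decidable)

private
  variable
    k l m n : ℕ
    X : Set

-- Given as a vector of rows; `true` is the entry 1 and `false` the entry 0.
Matrix : ℕ → ℕ → Set
Matrix m n = Vec (Vec Bool n) m

entry : Matrix m n → Fin m → Fin n → Bool
entry M i j = lookup (lookup M i) j

weight : Matrix m n → ℕ
weight M = Vec.sum (Vec.map (Vec.count (Bool._≟ true)) M)

Increasing : Vec (Fin n) k → Set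
Increasing v = ∀ i j → i < j → lookup v i < lookup v j

-- The rows and columns of M that are not deleted are listed, in their original
-- order, by r and c.  Turning 1-entries into 0-entries is allowed, so only the
-- 1-entries of A constrain M.
Contains : Matrix m n → Matrix k l → Set
Contains {m} {n} {k} {l} M A =
  Σ[ r ∈ Vec (Fin m) k ] Increasing r ×
  (Σ[ c ∈ Vec (Fin n) l ] Increasing c ×
    (∀ i j → entry A i j ≡ true → entry M (lookup r i) (lookup c j) ≡ true))

allVecs : List X → ∀ n → List (Vec X n)
allVecs xs zero    = [] ∷ []
allVecs xs (suc n) = cartesianProductWith _∷_ xs (allVecs xs n)

∈-allVecs : {xs : List X} → (∀ x → x ∈ xs) → (v : Vec X n) → v ∈ allVecs xs n
∈-allVecs complete []      = here refl
∈-allVecs complete (x ∷ v) =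
  ∈-cartesianProductWith⁺ _∷_ (complete x) (∈-allVecs complete v)

allMatrices : ∀ m n → List (Matrix m n)
allMatrices m n = allVecs (allVecs (false ∷ true ∷ []) n) m

∈-allMatrices : (M : Matrix m n) → M ∈ allMatrices m n
∈-allMatrices = ∈-allVecs (∈-allVecs λ where
  false → here refl
  true  → there (here refl))

anyVec? : {P : Vec (Fin n) k → Set} → Decidable P → Dec (∃[ v ] P v)
anyVec? P? = map′ satisfied (λ (v , p) → lose (∈-allVecs ∈-allFin v) p)
                  (any? P? (allVecs (allFin _) _))

increasing? : (v : Vec (Fin n) k) → Dec (Increasing v)
increasing? v = all? λ i → all? λ j → (i <? j) →-dec (lookup v i <? lookup v j)

contains? : (M : Matrix m n) (A : Matrix k l) → Dec (Contains M A)
contains? M A =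
  anyVec? λ r → increasing? r ×-dec
  anyVec? λ c → increasing? c ×-dec
  all? λ i → all? λ j →
    (entry A i j Bool.≟ true) →-dec (entry M (lookup r i) (lookup c j) Bool.≟ true)

avoiders : ∀ n → Matrix k l → List (Matrix n n)
avoiders n A = filter (λ M → ¬? (contains? M A)) (allMatrices n n)

-- The value is 0 if every n × n matrix contains A (possible only when A has no
-- 1-entry).
ex : ℕ → Matrix k l → ℕ
ex n A = max 0 (map weight (avoiders n A))

ex-upper : (A : Matrix k l) (M : Matrix n n) → ¬ Contains M A → weight M ℕ.≤ ex n A
ex-upper {n = n} A M avoids =
  All.lookup (xs≤max 0 (map weight (avoiders n A)))
    (∈-map⁺ weight (∈-filter⁺ (λ M → ¬? (contains? M A)) (∈-allMatrices M) avoids))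

ex-attained : (A : Matrix k l) (M : Matrix n n) → ¬ Contains M A →
              Σ[ M′ ∈ Matrix n n ] ¬ Contains M′ A × weight M′ ≡ ex n A
ex-attained {n = n} A M avoids with argmax-sel id 0 (map weight (avoiders n A))
... | inj₁ ex≡0 = M , avoids ,
  trans (ℕ.n≤0⇒n≡0 (subst (weight M ℕ.≤_) ex≡0 (ex-upper A M avoids))) (sym ex≡0)
... | inj₂ ex∈ with M′ , M′∈ , ex≡ ← ∈-map⁻ weight ex∈ =
  M′ , proj₂ (∈-filter⁻ (λ M → ¬? (contains? M A)) {xs = allMatrices n n} M′∈) , sym ex≡

-- `piece` sends each column to the index of the piece it lies in after cutting
-- at t - 1 vertical lines; monotonicity says that the pieces consist of
-- consecutive columns and are numbered from left to right.  A piece may be empty.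
ColumnPartite : ℕ → Matrix k l → Set
ColumnPartite {k} {l} t A =
  Σ[ piece ∈ (Fin l → Fin t) ] piece Preserves _≤_ ⟶ _≤_ ×
  (∀ i j j′ → piece j ≡ piece j′ →
    entry A i j ≡ true → entry A i j′ ≡ true → j ≡ j′)

-- f(n) = O(n^(p/q)) as n → ∞, for q ≥ 1: the inequality f(n) ≤ C · n^(p/q) with
-- both sides raised to the power q.  A real constant may be rounded up, so C is
-- taken to be a natural number.
_isO[n^_/_] : (ℕ → ℕ) → ℕ → ℕ → Set
f isO[n^ p / q ] =
  ∃[ C ] ∃[ N ] (∀ n → N ℕ.≤ n → f n ^ q ℕ.≤ C ^ q * n ^ p)

{-# OPTIONS --safe #-}
module Submission where

open import Defs
open import Data.Bool using (Bool; true; false)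
import Data.Bool.Properties as Bool
open import Data.Empty using (⊥)
open import Data.Fin as Fin using (Fin; zero; suc; toℕ; combine; quotient; remainder; inject₁; inject≤)
import Data.Fin.Properties as Fin
open import Data.List as List
  using (List; []; _∷_; _++_; map; length; filter; take; drop; tabulate; allFin; cartesianProductWith)
open import Data.List.Extrema.Nat using (max≤v⁺)
open import Data.List.Membership.Propositional using (_∈_; find; lose)
open import Data.List.Membership.Propositional.Properties
  using ( ∈-++⁻; ∈-++⁺ˡ; ∈-++⁺ʳ; ∈-map⁺; ∈-map⁻; ∈-filter⁻; ∈-allFin; ∈-lookup
        ; ∈-cartesianProductWith⁻)
open import Data.List.Properties
  using (length-++; length-map; length-take; length-drop; length-filter; length-tabulate)
open import Data.List.Relation.Binary.Sublist.Propositional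
  using (_⊆_; []; _∷_; _∷ʳ_; ⊆-trans; minimum) renaming (lookup to ⊆-lookup)
open import Data.List.Relation.Binary.Sublist.Propositional.Properties
  using (filter-⊆; take-⊆; drop-⊆; All-resp-⊆)
open import Data.List.Relation.Unary.All as All using (All; []; _∷_; all?)
open import Data.List.Relation.Unary.All.Properties using (take⁺; all-filter; map⁺)
open import Data.List.Relation.Unary.AllPairs using (AllPairs; []; _∷_)
import Data.List.Relation.Unary.AllPairs.Properties as AllPairs
open import Data.List.Relation.Unary.Any using (Any; here; there; any?)
open import Data.List.Relation.Unary.Unique.Propositional using (Unique)
import Data.List.Relation.Unary.Unique.Propositional.Properties as Unique
open import Data.Nat
  using ( ℕ; zero; suc; _+_; _*_; _∸_; _^_; _≤_; _<_; _≤?_; _<?_; z≤n; s≤s; s≤s⁻¹; z<s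
        ; NonZero; >-nonZero; >-nonZero⁻¹)
open import Data.Nat.DivMod using (_/_; _%_; m≡m%n+[m/n]*n; m%n<n; m/n*n≤m)
open import Data.Nat.Properties
open import Data.Nat.Tactic.RingSolver using (solve-∀)
open import Data.Product using (Σ-syntax; ∃-syntax; _×_; _,_; proj₁; proj₂)
open import Data.Sum using (_⊎_; inj₁; inj₂)
open import Data.Vec as Vec using (Vec; []; _∷_; lookup; replicate)
open import Data.Vec.Properties using (lookup∘tabulate; lookup-replicate)
open import Data.Vec.Relation.Binary.Pointwise.Extensional using (ext; extensional⇒inductive)
open import Data.Vec.Relation.Binary.Pointwise.Inductive as Pointwise using (Pointwise; []; _∷_)
open import Data.Vec.Relation.Unary.All as VAll using ([]; _∷_)
import Data.Vec.Relation.Unary.All.Properties as VAll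
open import Function using (_∘_; id)
open import Relation.Binary.PropositionalEquality
  using (_≡_; refl; sym; trans; cong; cong₂; subst; subst₂)
open import Relation.Nullary using (Dec; yes; no; ¬_; ¬?; contradiction)
open import Relation.Nullary.Decidable using (_×-dec_)
open import Relation.Unary using (Decidable)

-- Let M be an n × n matrix avoiding A, and write the row numbers with D = O(1) digits in base
-- b ≈ n^(1/D).  A code picks a digit position and k values for the digit there; applied to a
-- row r it yields k consecutive sets of rows that agree with r in the higher digits.  There are
-- only D · b^k codes, a small power of n, and every set of more than (k+1)^D rows contains some
-- r, and meets all k sets of rows described by some code relative to r.
--
-- Take a row r with at least t μ ones, and cut these ones into t consecutive groups of size μ.
-- Call a choice T of one column from each group charged if for some code each of the k sets of
-- rows relative to r contains a row having ones in all of T.  If half of the μ^t tuples were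
-- charged, a single code would serve a b^(-k-1) fraction of them, and by Erdős's theorem on
-- complete t-partite subhypergraphs it would serve all tuples of a product of t sets of l + 1
-- columns; M would then contain A.  This needs μ to exceed a power of b, which holds for the
-- relevant μ ≈ n^(1-1/t) as t ≥ 2.  So half of the tuples are uncharged, while each of the n^t
-- tuples is uncharged for at most (k+1)^D rows; double counting bounds the number of ones.

private
  variable
    X Y : Set
    P : Set
    t : ℕ

-- Finite sums and counting

∑ : List X → (X → ℕ) → ℕ
∑ []       f = 0
∑ (x ∷ xs) f = f x + ∑ xs f

∑-mono-∈ : (xs : List X) {f g : X → ℕ} → (∀ {x} → x ∈ xs → f x ≤ g x) → ∑ xs f ≤ ∑ xs g
∑-mono-∈ []       f≤g = z≤n
∑-mono-∈ (x ∷ xs) f≤g = +-mono-≤ (f≤g (here refl)) (∑-mono-∈ xs (f≤g ∘ there))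

∑-mono : (xs : List X) {f g : X → ℕ} → (∀ x → f x ≤ g x) → ∑ xs f ≤ ∑ xs g
∑-mono xs f≤g = ∑-mono-∈ xs (λ {x} _ → f≤g x)

∑-+ : (xs : List X) (f g : X → ℕ) → ∑ xs (λ x → f x + g x) ≡ ∑ xs f + ∑ xs g
∑-+ []       f g = refl
∑-+ (x ∷ xs) f g = trans (cong (f x + g x +_) (∑-+ xs f g)) (interchange (f x) (g x) (∑ xs f) (∑ xs g))
  where
  interchange : ∀ a b c d → a + b + (c + d) ≡ a + c + (b + d)
  interchange = solve-∀

∑-* : (xs : List X) (c : ℕ) (f : X → ℕ) → ∑ xs (λ x → c * f x) ≡ c * ∑ xs f
∑-* []       c f = sym (*-zeroʳ c)
∑-* (x ∷ xs) c f = trans (cong (c * f x +_) (∑-* xs c f)) (sym (*-distribˡ-+ c (f x) (∑ xs f)))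

∑-const : (xs : List X) (c : ℕ) → ∑ xs (λ _ → c) ≡ length xs * c
∑-const []       c = refl
∑-const (x ∷ xs) c = cong (c +_) (∑-const xs c)

∑-swap : (xs : List X) (ys : List Y) (f : X → Y → ℕ) →
         ∑ xs (λ x → ∑ ys (f x)) ≡ ∑ ys (λ y → ∑ xs (λ x → f x y))
∑-swap []       ys f = sym (trans (∑-const ys 0) (*-zeroʳ (length ys)))
∑-swap (x ∷ xs) ys f = trans (cong (∑ ys (f x) +_) (∑-swap xs ys f)) (sym (∑-+ ys (f x) _))

∑-++ : (xs ys : List X) (f : X → ℕ) → ∑ (xs ++ ys) f ≡ ∑ xs f + ∑ ys f
∑-++ []       ys f = refl
∑-++ (x ∷ xs) ys f = trans (cong (f x +_) (∑-++ xs ys f)) (sym (+-assoc (f x) _ _))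

∑-map : (h : X → Y) (xs : List X) (f : Y → ℕ) → ∑ (map h xs) f ≡ ∑ xs (f ∘ h)
∑-map h []       f = refl
∑-map h (x ∷ xs) f = cong (f (h x) +_) (∑-map h xs f)

∑-≥ : {xs : List X} {x : X} (f : X → ℕ) → x ∈ xs → f x ≤ ∑ xs f
∑-≥ f (here refl) = m≤m+n _ _
∑-≥ f (there x∈)  = ≤-trans (∑-≥ f x∈) (m≤n+m _ _)

∑-⊆ : {xs ys : List X} (f : X → ℕ) → xs ⊆ ys → ∑ xs f ≤ ∑ ys f
∑-⊆ f []         = z≤n
∑-⊆ f (y ∷ʳ p)   = ≤-trans (∑-⊆ f p) (m≤n+m _ _)
∑-⊆ f (refl ∷ p) = +-monoʳ-≤ _ (∑-⊆ f p)

∑-≥-All : {xs : List X} {f : X → ℕ} {c : ℕ} → All (λ x → c ≤ f x) xs → length xs * c ≤ ∑ xs f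
∑-≥-All []        = z≤n
∑-≥-All (p ∷ ps) = +-mono-≤ p (∑-≥-All ps)

-- A member of maximal value reaches the average. Positivity of the sum guarantees that there is a
-- member at all.
pigeonhole : (xs : List X) (f : X → ℕ) → 0 < ∑ xs f → ∃[ x ] x ∈ xs × ∑ xs f ≤ length xs * f x
pigeonhole (x ∷ xs) f 0<∑ with ∑ xs f in eq
... | zero  = x , here refl , +-monoʳ-≤ (f x) z≤n
... | suc _ with pigeonhole xs f (subst (0 <_) (sym eq) z<s)
...   | y , y∈ , le with ≤-total (f x) (f y)
...     | inj₁ x≤y = y , there y∈ , +-mono-≤ x≤y (subst (_≤ length xs * f y) eq le)
...     | inj₂ y≤x = x , here refl ,
  +-monoʳ-≤ (f x) (≤-trans (subst (_≤ length xs * f y) eq le) (*-monoʳ-≤ (length xs) y≤x))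

𝟙 : Dec P → ℕ
𝟙 (yes _) = 1
𝟙 (no _)  = 0

𝟙≤1 : (p? : Dec P) → 𝟙 p? ≤ 1
𝟙≤1 (yes _) = ≤-refl
𝟙≤1 (no _)  = z≤n

𝟙-true : (p? : Dec P) → P → 1 ≤ 𝟙 p?
𝟙-true (yes _) p = ≤-refl
𝟙-true (no ¬p) p = contradiction p ¬p

𝟙-≤ : (p? : Dec P) {c : ℕ} → (P → 1 ≤ c) → 𝟙 p? ≤ c
𝟙-≤ (yes p) h = h p
𝟙-≤ (no _)  h = z≤n

count≡length-filter : {P : X → Set} (P? : Decidable P) (xs : List X) →
                      ∑ xs (λ x → 𝟙 (P? x)) ≡ length (filter P? xs)
count≡length-filter P? []       = refl
count≡length-filter P? (x ∷ xs) with P? x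
... | yes _ = cong suc (count≡length-filter P? xs)
... | no  _ = count≡length-filter P? xs

count≤length : {P : X → Set} (P? : Decidable P) (xs : List X) → ∑ xs (λ x → 𝟙 (P? x)) ≤ length xs
count≤length P? xs = subst (_≤ length xs) (sym (count≡length-filter P? xs)) (length-filter P? xs)

length-cartesianProductWith : {Z : Set} (h : X → Y → Z) (xs : List X) (ys : List Y) →
  length (cartesianProductWith h xs ys) ≡ length xs * length ys
length-cartesianProductWith h []       ys = refl
length-cartesianProductWith h (x ∷ xs) ys = trans (length-++ (map (h x) ys))
  (cong₂ _+_ (length-map (h x) ys) (length-cartesianProductWith h xs ys))

∑-cartesianProductWith : {Z : Set} (h : X → Y → Z) (xs : List X) (ys : List Y) (f : Z → ℕ) →
  ∑ (cartesianProductWith h xs ys) f ≡ ∑ xs (λ x → ∑ ys (λ y → f (h x y)))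
∑-cartesianProductWith h []       ys f = refl
∑-cartesianProductWith h (x ∷ xs) ys f = trans (∑-++ (map (h x) ys) _ f)
  (cong₂ _+_ (∑-map (h x) ys f) (∑-cartesianProductWith h xs ys f))

length-allVecs : (xs : List X) (n : ℕ) → length (allVecs xs n) ≡ length xs ^ n
length-allVecs xs zero    = refl
length-allVecs xs (suc n) = trans (length-cartesianProductWith _∷_ xs (allVecs xs n))
  (cong (length xs *_) (length-allVecs xs n))

tuples : Vec (List X) t → List (Vec X t)
tuples []       = [] ∷ []
tuples (X ∷ Xs) = cartesianProductWith _∷_ X (tuples Xs)

length-tuples : {m : ℕ} {Xs : Vec (List X) t} → VAll.All (λ X → length X ≡ m) Xs →
                length (tuples Xs) ≡ m ^ t
length-tuples []                     = refl
length-tuples {Xs = X ∷ Xs} (eq ∷ p) =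
  trans (length-cartesianProductWith _∷_ X (tuples Xs)) (cong₂ _*_ eq (length-tuples p))

∑-tuples-⊆ : {Xs Ys : Vec (List X) t} (f : Vec X t → ℕ) → Pointwise _⊆_ Xs Ys →
             ∑ (tuples Xs) f ≤ ∑ (tuples Ys) f
∑-tuples-⊆ f [] = ≤-refl
∑-tuples-⊆ {Xs = X ∷ Xs} {Ys = Y ∷ Ys} f (p ∷ ps) = begin
  ∑ (tuples (X ∷ Xs)) f                           ≡⟨ ∑-cartesianProductWith _∷_ X (tuples Xs) f ⟩
  ∑ X (λ a → ∑ (tuples Xs) (λ v → f (a ∷ v)))     ≤⟨ ∑-mono X (λ a → ∑-tuples-⊆ (λ v → f (a ∷ v)) ps) ⟩
  ∑ X (λ a → ∑ (tuples Ys) (λ v → f (a ∷ v)))     ≤⟨ ∑-⊆ _ p ⟩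
  ∑ Y (λ a → ∑ (tuples Ys) (λ v → f (a ∷ v)))     ≡⟨ ∑-cartesianProductWith _∷_ Y (tuples Ys) f ⟨
  ∑ (tuples (Y ∷ Ys)) f                           ∎
  where open ≤-Reasoning

-- Dense t-partite hypergraphs contain complete t-partite subhypergraphs

combinations : ℕ → List X → List (List X)
combinations zero    xs       = [] ∷ []
combinations (suc L) []       = []
combinations (suc L) (x ∷ xs) = map (x ∷_) (combinations L xs) ++ combinations (suc L) xs

-- Pascal's rule with a crude power in place of the binomial coefficient; only the order of
-- magnitude enters the density estimate.
length-combinations : (L : ℕ) (xs : List X) → length (combinations L xs) ≤ length xs ^ L
length-combinations zero    xs       = ≤-refl
length-combinations (suc L) []       = z≤n
length-combinations (suc L) (x ∷ xs) = begin
  length (map (x ∷_) (combinations L xs) ++ combinations (suc L) xs)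
    ≡⟨ length-++ (map (x ∷_) (combinations L xs)) ⟩
  length (map (x ∷_) (combinations L xs)) + length (combinations (suc L) xs)
    ≡⟨ cong (_+ length (combinations (suc L) xs)) (length-map (x ∷_) (combinations L xs)) ⟩
  length (combinations L xs) + length (combinations (suc L) xs)
    ≤⟨ +-mono-≤ (length-combinations L xs) (length-combinations (suc L) xs) ⟩
  suc (length xs) * length xs ^ L
    ≤⟨ *-monoʳ-≤ (suc (length xs)) (^-monoˡ-≤ L (n≤1+n (length xs))) ⟩
  suc (length xs) ^ suc L ∎
  where open ≤-Reasoning

combinations-sound : (L : ℕ) (xs : List X) {S : List X} → S ∈ combinations L xs →
                     S ⊆ xs × length S ≡ L
combinations-sound zero    xs       (here refl) = minimum xs , refl
combinations-sound (suc L) (x ∷ xs) S∈ with ∈-++⁻ (map (x ∷_) (combinations L xs)) S∈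
... | inj₂ S∈′ with p , eq ← combinations-sound (suc L) xs S∈′ = (x ∷ʳ p) , eq
... | inj₁ S∈′ with S′ , S′∈ , refl ← ∈-map⁻ (x ∷_) S∈′ with p , eq ← combinations-sound L xs S′∈ =
  (refl ∷ p) , cong suc eq

combinations-complete : {P : X → Set} (P? : Decidable P) (L : ℕ) (xs : List X) →
  L ≤ ∑ xs (λ x → 𝟙 (P? x)) → ∃[ S ] S ∈ combinations L xs × All P S
combinations-complete P? zero    xs       le = [] , here refl , []
combinations-complete P? (suc L) (x ∷ xs) le with P? x
... | yes p with S , S∈ , ps ← combinations-complete P? L xs (s≤s⁻¹ le) =
  x ∷ S , ∈-++⁺ˡ (∈-map⁺ (x ∷_) S∈) , p ∷ ps
... | no _  with S , S∈ , ps ← combinations-complete P? (suc L) xs le =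
  S , ∈-++⁺ʳ (map (x ∷_) (combinations L xs)) S∈ , ps

-- A copy of the complete `t`-partite hypergraph with `L` vertices in each class, where `E` is the
-- edge relation and `Xs` are the given vertex classes.
CompleteBox : ℕ → Vec (List X) t → (Vec X t → Set) → Set
CompleteBox {X} {t} L Xs E =
  Σ[ Ss ∈ Vec (List X) t ] Pointwise _⊆_ Ss Xs × VAll.All (λ S → length S ≡ L) Ss ×
    (∀ v → Pointwise _∈_ v Ss → E v)

module _ {X : Set} (X₁ : List X) (V : List Y) {E : X → Y → Set} (E? : ∀ a v → Dec (E a v)) where

  private
    d : X → ℕ
    d a = ∑ V (λ v → 𝟙 (E? a v))

  -- Vertices of degree below N/(2s), where N is the length of `V`, carry at most half of the
  -- guaranteed mN/s edges, m being the length of `X₁`. The other half must come from the remaining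
  -- vertices, each of degree at most N.
  many-large-degrees : (s : ℕ) → .{{NonZero (length V)}} →
    length X₁ * length V ≤ s * ∑ X₁ d →
    length X₁ ≤ 2 * s * length (filter (λ a → length V ≤? 2 * s * d a) X₁)
  many-large-degrees s dense = *-cancelʳ-≤ _ _ N (+-cancelˡ-≤ (m * N) _ _ (begin
    m * N + m * N                          ≤⟨ +-mono-≤ dense dense ⟩
    s * ∑ X₁ d + s * ∑ X₁ d                ≡⟨ lem₁ s (∑ X₁ d) ⟩
    2 * s * ∑ X₁ d                         ≡⟨ ∑-* X₁ (2 * s) d ⟨
    ∑ X₁ (λ a → 2 * s * d a)               ≤⟨ ∑-mono X₁ bound ⟩
    ∑ X₁ (λ a → N + 2 * s * N * 𝟙 (G? a))  ≡⟨ ∑-+ X₁ _ _ ⟩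
    ∑ X₁ (λ _ → N) + ∑ X₁ (λ a → 2 * s * N * 𝟙 (G? a))
      ≡⟨ cong₂ _+_ (∑-const X₁ N) (∑-* X₁ (2 * s * N) _) ⟩
    m * N + 2 * s * N * ∑ X₁ (λ a → 𝟙 (G? a))
      ≡⟨ cong (λ z → m * N + 2 * s * N * z) (count≡length-filter G? X₁) ⟩
    m * N + 2 * s * N * length (filter G? X₁)
      ≡⟨ cong (m * N +_) (lem₂ (2 * s) N (length (filter G? X₁))) ⟩
    m * N + 2 * s * length (filter G? X₁) * N ∎))
    where
    open ≤-Reasoning
    m = length X₁
    N = length V
    G? = λ a → length V ≤? 2 * s * d a
    lem₁ : ∀ s d → s * d + s * d ≡ 2 * s * d
    lem₁ = solve-∀
    lem₂ : ∀ a b c → a * b * c ≡ a * c * b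
    lem₂ = solve-∀
    bound : ∀ a → 2 * s * d a ≤ N + 2 * s * N * 𝟙 (G? a)
    bound a with G? a
    ... | yes _ = ≤-trans (*-monoʳ-≤ (2 * s) (count≤length (E? a) V))
                    (subst (_≤ N + 2 * s * N * 1) (*-identityʳ _) (m≤n+m _ N))
    ... | no ¬g = ≤-trans (<⇒≤ (≰⇒> ¬g)) (m≤m+n N _)

  -- Double counting of the pairs (S , v) with S a set of L neighbours of v, taken inside
  -- 4sL vertices of large degree.
  dense-link : (s L : ℕ) .{{_ : NonZero (length V)}} .{{_ : NonZero s}} .{{_ : NonZero L}} →
    length X₁ * length V ≤ s * ∑ X₁ d → 2 * s * (4 * s * L) ≤ length X₁ →
    ∃[ S ] S ⊆ X₁ × length S ≡ L ×
      length V ≤ 4 * s * (4 * s * L) ^ L * ∑ V (λ v → 𝟙 (all? (λ a → E? a v) S))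
  dense-link s L {{_}} {{s≢0}} {{L≢0}} dense big = from-pigeonhole
    (pigeonhole combs links (n≢0⇒n>0 λ Z≡0 → <⇒≱ N>0
      (subst (length V ≤_) (trans (cong (4 * s *_) Z≡0) (*-zeroʳ (4 * s))) N≤4sZ)))
    where
    open ≤-Reasoning
    N = length V
    -- The `u` selected vertices send out at least uN/(2s) = 2LN edges. Those v with fewer than `L`
    -- neighbours among them receive at most LN, so half of the edges remain for the rest.
    u = 4 * s * L
    instance
      2s≢0 : NonZero (2 * s)
      2s≢0 = m*n≢0 2 s
      2sL≢0 : NonZero (2 * s * L)
      2sL≢0 = m*n≢0 (2 * s) L
    N>0 : 0 < N
    N>0 = >-nonZero⁻¹ N
    G? = λ a → N ≤? 2 * s * d a
    G = filter G? X₁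
    u≤|G| : u ≤ length G
    u≤|G| = *-cancelˡ-≤ (2 * s) (≤-trans big (many-large-degrees s dense))
    U = take u G
    |U| : length U ≡ u
    |U| = trans (length-take u G) (m≤n⇒m⊓n≡m u≤|G|)
    U⊆X₁ : U ⊆ X₁
    U⊆X₁ = ⊆-trans (take-⊆ u G) (filter-⊆ G? X₁)
    deg : Y → ℕ
    deg v = ∑ U (λ a → 𝟙 (E? a v))
    combs = combinations L U
    links : List X → ℕ
    links S = ∑ V (λ v → 𝟙 (all? (λ a → E? a v) S))
    -- Either v has fewer than `L` neighbours in `U`, or some `L`-set of them occurs among `combs`,
    -- and then the trivial bound `u` on the degree is paid for by that set.
    deg≤ : ∀ v → deg v ≤ L + u * ∑ combs (λ S → 𝟙 (all? (λ a → E? a v) S))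
    deg≤ v with L ≤? deg v
    ... | no  L≰ = ≤-trans (<⇒≤ (≰⇒> L≰)) (m≤m+n L _)
    ... | yes L≤ with S , S∈ , ps ← combinations-complete (λ a → E? a v) L U L≤ = begin
      deg v       ≤⟨ count≤length (λ a → E? a v) U ⟩
      length U    ≡⟨ |U| ⟩
      u           ≡⟨ *-identityʳ u ⟨
      u * 1       ≤⟨ *-monoʳ-≤ u (≤-trans (𝟙-true (all? (λ a → E? a v) S) ps) (∑-≥ _ S∈)) ⟩
      u * ∑ combs _      ≤⟨ m≤n+m _ L ⟩
      L + u * ∑ combs _  ∎
    total : ∑ V deg ≤ N * L + u * ∑ combs links
    total = begin
      ∑ V deg  ≤⟨ ∑-mono V deg≤ ⟩
      ∑ V (λ v → L + u * ∑ combs (λ S → 𝟙 (all? (λ a → E? a v) S)))  ≡⟨ ∑-+ V _ _ ⟩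
      _  ≡⟨ cong₂ _+_ (∑-const V L) (trans (∑-* V u _) (cong (u *_) (∑-swap V combs _))) ⟩
      N * L + u * ∑ combs links  ∎
    N≤4sZ : N ≤ 4 * s * ∑ combs links
    N≤4sZ = *-cancelˡ-≤ (2 * s * L) (+-cancelˡ-≤ (2 * s * L * N) _ _ (begin
      2 * s * L * N + 2 * s * L * N  ≡⟨ lem₁ s L N ⟩
      u * N                          ≡⟨ cong (_* N) |U| ⟨
      length U * N                   ≤⟨ ∑-≥-All (take⁺ u (all-filter G? X₁)) ⟩
      ∑ U (λ a → 2 * s * d a)        ≡⟨ ∑-* U (2 * s) d ⟩
      2 * s * ∑ U d                  ≡⟨ cong (2 * s *_) (∑-swap U V _) ⟩
      2 * s * ∑ V deg                ≤⟨ *-monoʳ-≤ (2 * s) total ⟩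
      2 * s * (N * L + u * ∑ combs links)  ≡⟨ lem₂ s L N (∑ combs links) ⟩
      2 * s * L * N + 2 * s * L * (4 * s * ∑ combs links) ∎))
      where
      lem₁ : ∀ s L N → 2 * s * L * N + 2 * s * L * N ≡ 4 * s * L * N
      lem₁ = solve-∀
      lem₂ : ∀ s L N Z → 2 * s * (N * L + 4 * s * L * Z) ≡ 2 * s * L * N + 2 * s * L * (4 * s * Z)
      lem₂ = solve-∀
    from-pigeonhole : ∃[ S ] S ∈ combs × ∑ combs links ≤ length combs * links S → _
    from-pigeonhole (S , S∈ , le) with S⊆U , |S| ← combinations-sound L U S∈ =
      S , ⊆-trans S⊆U U⊆X₁ , |S| , (begin
        N                              ≤⟨ N≤4sZ ⟩
        4 * s * ∑ combs links          ≤⟨ *-monoʳ-≤ (4 * s) le ⟩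
        4 * s * (length combs * links S)
          ≤⟨ *-monoʳ-≤ (4 * s) (*-monoˡ-≤ (links S)
               (subst (λ z → length combs ≤ z ^ L) |U| (length-combinations L U))) ⟩
        4 * s * (u ^ L * links S)      ≡⟨ *-assoc (4 * s) (u ^ L) (links S) ⟨
        4 * s * u ^ L * links S        ∎)

private
  -- Puts the size condition of `dense-link` into the form of a pure power of `s`, so that the
  -- induction has to follow one exponent only.
  cubic-bound : ∀ s L → 8 * L ≤ s → 2 * s * (4 * s * L) ≤ s ^ 3
  cubic-bound s L 8L≤s = begin
    2 * s * (4 * s * L)  ≡⟨ lem₁ s L ⟩
    8 * L * (s * s)      ≤⟨ *-monoˡ-≤ (s * s) 8L≤s ⟩
    s * (s * s)          ≡⟨ lem₂ s ⟩
    s ^ 3                ∎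
    where
    open ≤-Reasoning
    lem₁ : ∀ s L → 2 * s * (4 * s * L) ≡ 8 * L * (s * s)
    lem₁ = solve-∀
    lem₂ : ∀ s → s * (s * s) ≡ s * (s * (s * 1))
    lem₂ = solve-∀

  -- The density lost on passing to a link, again as a pure power: `4 * s` and `4 * s * L` are each
  -- at most s².
  density-bound : ∀ s L .{{_ : NonZero L}} → 8 * L ≤ s → 4 * s * (4 * s * L) ^ L ≤ s ^ (2 * suc L)
  density-bound s L 8L≤s = begin
    4 * s * (4 * s * L) ^ L
      ≤⟨ *-mono-≤ (*-monoˡ-≤ s 4≤s) (^-monoˡ-≤ L (≤-trans (≤-reflexive (lem s L)) (*-monoʳ-≤ s 4L≤s))) ⟩
    s * s * (s * s) ^ L  ≡⟨⟩
    (s * s) ^ suc L      ≡⟨ cong (λ z → (s * z) ^ suc L) (*-identityʳ s) ⟨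
    (s ^ 2) ^ suc L      ≡⟨ ^-*-assoc s 2 (suc L) ⟩
    s ^ (2 * suc L)      ∎
    where
    open ≤-Reasoning
    lem : ∀ s L → 4 * s * L ≡ s * (4 * L)
    lem = solve-∀
    4L≤s : 4 * L ≤ s
    4L≤s = ≤-trans (*-monoˡ-≤ L {4} {8} (m≤m+n 4 4)) 8L≤s
    4≤s : 4 ≤ s
    4≤s = ≤-trans (*-monoʳ-≤ 4 (>-nonZero⁻¹ L)) 4L≤s

-- One may think of 1/s as the density of E: passing to the common link of L vertices of
-- the first class replaces s by s ^ (2 * suc L).
complete-box : (L : ℕ) .{{_ : NonZero L}} (s m : ℕ) → 8 * L ≤ s → s ^ ((2 * suc L) ^ t) ≤ m →
  (Xs : Vec (List X) t) → VAll.All (λ X → length X ≡ m) Xs →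
  {E : Vec X t → Set} (E? : Decidable E) → m ^ t ≤ s * ∑ (tuples Xs) (λ v → 𝟙 (E? v)) →
  CompleteBox L Xs E
complete-box L s m 8L≤s s≤m [] [] E? dense with E? []
... | yes e = [] , [] , [] , λ where [] [] → e
... | no _  = contradiction (subst (1 ≤_) (*-zeroʳ s) dense) λ ()
complete-box {suc t} L s m 8L≤s s≤m (X₁ ∷ Xs) (|X₁| ∷ |Xs|) {E} E? dense =
  extend (dense-link X₁ V (λ a v → E? (a ∷ v)) s L
    (≤-trans (≤-reflexive (cong₂ _*_ |X₁| |V|))
      (subst (λ z → m ^ suc t ≤ s * z) (∑-cartesianProductWith _∷_ X₁ V _) dense))
    (subst (_ ≤_) (sym |X₁|) (≤-trans (cubic-bound s L 8L≤s) (≤-trans s³≤ s≤m))))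
  where
  V = tuples Xs
  w = 2 * suc L
  |V| : length V ≡ m ^ t
  |V| = length-tuples |Xs|
  instance
    s≢0 : NonZero s
    s≢0 = >-nonZero (≤-trans (≤-trans (>-nonZero⁻¹ L) (m≤n*m L 8)) 8L≤s)
    m≢0 : NonZero m
    m≢0 = >-nonZero (≤-trans (m^n>0 s (w ^ suc t)) s≤m)
    V≢0 : NonZero (length V)
    V≢0 = subst NonZero (sym |V|) (m^n≢0 m t)
  4≤w : 4 ≤ w
  4≤w = *-monoʳ-≤ 2 (s≤s (>-nonZero⁻¹ L))
  s³≤ : s ^ 3 ≤ s ^ (w ^ suc t)
  s³≤ = ^-monoʳ-≤ s (≤-trans (≤-trans (n≤1+n 3) 4≤w) (m≤m*n w (w ^ t) {{m^n≢0 w t}}))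
  8L≤sʷ : 8 * L ≤ s ^ w
  8L≤sʷ = ≤-trans 8L≤s (subst (_≤ s ^ w) (*-identityʳ s) (^-monoʳ-≤ s {1} {w} (≤-trans (s≤s z≤n) 4≤w)))
  extend : ∃[ S ] S ⊆ X₁ × length S ≡ L ×
             length V ≤ 4 * s * (4 * s * L) ^ L * ∑ V (λ v → 𝟙 (all? (λ a → E? (a ∷ v)) S)) →
           CompleteBox L (X₁ ∷ Xs) E
  extend (S , S⊆X₁ , |S| , dense′)
    -- The edges for the remaining classes are the tuples joined to all of `S`. As (s^w)^(w^t) =
    -- s^(w^(t+1)), the same lower bound on `m` serves the smaller instance.
    with Ss , Ss⊆ , |Ss| , full ← complete-box L (s ^ w) m 8L≤sʷ
           (subst (_≤ m) (sym (^-*-assoc s w (w ^ t))) s≤m) Xs |Xs|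
           (λ v → all? (λ a → E? (a ∷ v)) S)
           (≤-trans (≤-reflexive (sym |V|)) (≤-trans dense′ (*-monoˡ-≤ _ (density-bound s L 8L≤s)))) =
    S ∷ Ss , S⊆X₁ ∷ Ss⊆ , |S| ∷ |Ss| , λ where (a ∷ v) (a∈S ∷ v∈) → All.lookup (full v v∈) a∈S

-- Separating sparse sets of rows

lookup-mono-< : ∀ {n} {xs : List (Fin n)} → AllPairs Fin._<_ xs →
                ∀ {i j} → i Fin.< j → List.lookup xs i Fin.< List.lookup xs j
lookup-mono-< (p ∷ ps) {zero}  {suc j} i<j = All.lookup p (∈-lookup j)
lookup-mono-< (p ∷ ps) {suc i} {suc j} i<j = lookup-mono-< ps (s≤s⁻¹ i<j)

increasing-choice : ∀ {n} k {xs : List (Fin n)} → AllPairs Fin._<_ xs → k ≤ length xs →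
                    Σ[ v ∈ Vec (Fin n) k ] Increasing v × (∀ i → lookup v i ∈ xs)
increasing-choice k {xs} sorted k≤ = Vec.tabulate g , incr , mem
  where
  g : Fin k → _
  g i = List.lookup xs (inject≤ i k≤)
  incr : Increasing (Vec.tabulate g)
  incr i j i<j rewrite lookup∘tabulate g i | lookup∘tabulate g j =
    lookup-mono-< sorted (subst₂ _<_ (sym (Fin.toℕ-inject≤ i k≤)) (sym (Fin.toℕ-inject≤ j k≤)) i<j)
  mem : ∀ i → lookup (Vec.tabulate g) i ∈ xs
  mem i rewrite lookup∘tabulate g i = ∈-lookup (inject≤ i k≤)

allFin-sorted : ∀ n → AllPairs Fin._<_ (allFin n)
allFin-sorted n = AllPairs.tabulate⁺-< id

-- A code is a digit position together with k values for the digit there; only increasing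
-- values are of use, which Block enforces.
Code : ℕ → ℕ → ℕ → Set
Code b k zero    = ⊥
Code b k (suc D) = Vec (Fin b) k ⊎ Code b k D

codes : ∀ b k D → List (Code b k D)
codes b k zero    = []
codes b k (suc D) = map inj₁ (allVecs (allFin b) k) ++ map inj₂ (codes b k D)

∈-codes : ∀ {b k} D (q : Code b k D) → q ∈ codes b k D
∈-codes (suc D)         (inj₁ v) = ∈-++⁺ˡ (∈-map⁺ inj₁ (∈-allVecs ∈-allFin v))
∈-codes {b} {k} (suc D) (inj₂ q) = ∈-++⁺ʳ (map inj₁ (allVecs (allFin b) k)) (∈-map⁺ inj₂ (∈-codes D q))

length-codes : ∀ b k D → length (codes b k D) ≡ D * b ^ k
length-codes b k zero    = refl
length-codes b k (suc D) = trans (length-++ (map inj₁ (allVecs (allFin b) k))) (cong₂ _+_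
  (trans (length-map inj₁ (allVecs (allFin b) k))
    (trans (length-allVecs (allFin b) k) (cong (_^ k) (length-tabulate {n = b} id))))
  (trans (length-map inj₂ (codes b k D)) (length-codes b k D)))

-- `quotient` by `b ^ D` reads off the leading digit, so positions are counted from the most
-- significant one. `inj₂` demands agreement with `r` there and moves on; `inj₁` prescribes the
-- digit and leaves all lower digits free.
Block : ∀ {b k} D → Code b k D → Fin (b ^ D) → Fin k → Fin (b ^ D) → Set
Block {b} (suc D) (inj₁ v) r i x = Increasing v × quotient {b} (b ^ D) x ≡ lookup v i
Block {b} (suc D) (inj₂ q) r i x =
  quotient {b} (b ^ D) x ≡ quotient {b} (b ^ D) r ×
  Block D q (remainder {b} (b ^ D) r) i (remainder {b} (b ^ D) x)

block? : ∀ {b k} D (q : Code b k D) r i x → Dec (Block D q r i x)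
block? {b} (suc D) (inj₁ v) r i x = increasing? v ×-dec (quotient {b} (b ^ D) x Fin.≟ lookup v i)
block? {b} (suc D) (inj₂ q) r i x =
  (quotient {b} (b ^ D) x Fin.≟ quotient {b} (b ^ D) r) ×-dec
  block? D q (remainder {b} (b ^ D) r) i (remainder {b} (b ^ D) x)

combine-monoʳ-< : ∀ {m n} (i : Fin m) {k l : Fin n} → k Fin.< l → combine i k Fin.< combine i l
combine-monoʳ-< {n = n} i {k} {l} k<l = subst₂ _<_ (sym (Fin.toℕ-combine i k)) (sym (Fin.toℕ-combine i l))
  (+-monoʳ-< (n * toℕ i) k<l)

quotient-cancel-< : ∀ {m} n (x y : Fin (m * n)) → quotient {m} n x Fin.< quotient {m} n y → x Fin.< y
quotient-cancel-< {m} n x y lt = subst₂ Fin._<_ (Fin.combine-remQuot {m} n x) (Fin.combine-remQuot {m} n y)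
  (Fin.combine-monoˡ-< (remainder {m} n x) (remainder {m} n y) lt)

remainder-cancel-< : ∀ {m} n (x y : Fin (m * n)) → quotient {m} n x ≡ quotient {m} n y →
                     remainder {m} n x Fin.< remainder {m} n y → x Fin.< y
remainder-cancel-< {m} n x y eq lt = subst₂ Fin._<_
  (trans (cong (λ c → combine c (remainder {m} n x)) (sym eq)) (Fin.combine-remQuot {m} n x))
  (Fin.combine-remQuot {m} n y)
  (combine-monoʳ-< (quotient {m} n y) lt)

quotient-remainder-injective : ∀ {m} n (x y : Fin (m * n)) → quotient {m} n x ≡ quotient {m} n y →
                               remainder {m} n x ≡ remainder {m} n y → x ≡ y
quotient-remainder-injective {m} n x y eq₁ eq₂ =
  trans (sym (Fin.combine-remQuot {m} n x)) (trans (cong₂ combine eq₁ eq₂) (Fin.combine-remQuot {m} n y))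

-- Members of both blocks share with `r` all digits before the position of the code, so their order
-- is decided at that position, where `v` increases.
block-mono : ∀ {b k} D (q : Code b k D) r {i j x y} → i Fin.< j →
             Block D q r i x → Block D q r j y → x Fin.< y
block-mono {b} (suc D) (inj₁ v) r {i} {j} {x} {y} i<j (incr , p) (_ , p′) =
  quotient-cancel-< {b} (b ^ D) x y (subst₂ Fin._<_ (sym p) (sym p′) (incr i j i<j))
block-mono {b} (suc D) (inj₂ q) r {x = x} {y} i<j (eq , p) (eq′ , p′) =
  remainder-cancel-< {b} (b ^ D) x y (trans eq (sym eq′)) (block-mono D q _ i<j p p′)

length≤∑-fibres : ∀ {c} (h : X → Fin c) (xs : List X) →
                  length xs ≤ ∑ (allFin c) (λ i → length (filter (λ x → h x Fin.≟ i) xs))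
length≤∑-fibres {c = c} h xs = begin
  length xs                                                   ≡⟨ *-identityʳ (length xs) ⟨
  length xs * 1                                               ≡⟨ ∑-const xs 1 ⟨
  ∑ xs (λ _ → 1)                                              ≤⟨ ∑-mono xs (λ x → ≤-trans
    (𝟙-true (h x Fin.≟ h x) refl) (∑-≥ (λ i → 𝟙 (h x Fin.≟ i)) (∈-allFin (h x)))) ⟩
  ∑ xs (λ x → ∑ (allFin c) (λ i → 𝟙 (h x Fin.≟ i)))           ≡⟨ ∑-swap xs (allFin c) _ ⟩
  ∑ (allFin c) (λ i → ∑ xs (λ x → 𝟙 (h x Fin.≟ i)))           ≤⟨ ∑-mono (allFin c) (λ i →
    ≤-reflexive (count≡length-filter (λ x → h x Fin.≟ i) xs)) ⟩
  ∑ (allFin c) (λ i → length (filter (λ x → h x Fin.≟ i) xs)) ∎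
  where open ≤-Reasoning

-- Induction on the number of digits. If more than (k+1)^D elements share a leading digit, the
-- search continues among them; otherwise many leading digits occur, and `k` of them form a code.
-- Dropping digits keeps `f` injective only on the surviving elements, hence the hypothesis of
-- injectivity on `R`.
separation : ∀ b k D (f : X → Fin (b ^ D)) (R : List X) → Unique R →
  (∀ {x y} → x ∈ R → y ∈ R → f x ≡ f y → x ≡ y) → suc k ^ D < length R →
  ∃[ r ] r ∈ R × ∃[ q ] ∀ i → ∃[ x ] x ∈ R × Block {b} {k} D q (f r) i (f x)
-- Without digits all values lie in `Fin 1`, so injectivity leaves room for one element, while `R`
-- has more than (k+1)^0 = 1.
separation b k zero f (x ∷ [])    _                inj big = contradiction big λ { (s≤s ()) }
separation b k zero f (x ∷ y ∷ R) ((x≢y ∷ _) ∷ _) inj big =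
  contradiction (inj (here refl) (there (here refl)) (subsingleton (f x) (f y))) x≢y
  where
  subsingleton : (i j : Fin 1) → i ≡ j
  subsingleton zero zero = refl
separation {X} b k (suc D) f R uniq inj big
  with Fin.any? (λ c → suc k ^ D <? length (filter (λ x → quotient {b} (b ^ D) (f x) Fin.≟ c) R))
... | yes (c , big′) =
  let r , r∈ , q , hits = separation b k D (λ x → remainder {b} (b ^ D) (f x)) (filter c? R)
                            (Unique.filter⁺ c? uniq) inj′ big′
      r∈R , qr = unfilter r∈
  in r , r∈R , inj₂ q , λ i →
       let x , x∈ , blk = hits i
           x∈R , qx = unfilter x∈
       in x , x∈R , trans qx (sym qr) , blk
  where
  c? = λ x → quotient {b} (b ^ D) (f x) Fin.≟ c
  unfilter : ∀ {x} → x ∈ filter c? R → x ∈ R × quotient {b} (b ^ D) (f x) ≡ c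
  unfilter = ∈-filter⁻ c? {xs = R}
  inj′ : ∀ {x y} → x ∈ filter c? R → y ∈ filter c? R →
         remainder {b} (b ^ D) (f x) ≡ remainder {b} (b ^ D) (f y) → x ≡ y
  inj′ {x} {y} x∈ y∈ eq with x∈R , qx ← unfilter x∈ | y∈R , qy ← unfilter y∈ =
    inj x∈R y∈R (quotient-remainder-injective {b} (b ^ D) (f x) (f y) (trans qx (sym qy)) eq)
... | no small = branch
  where
  open ≤-Reasoning
  hi : X → Fin b
  hi x = quotient {b} (b ^ D) (f x)
  fibre : Fin b → List X
  fibre c = filter (λ x → hi x Fin.≟ c) R
  nonempty? = λ c → 1 ≤? length (fibre c)
  C = filter nonempty? (allFin b)
  fibre≤ : ∀ c → length (fibre c) ≤ suc k ^ D * 𝟙 (nonempty? c)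
  fibre≤ c with nonempty? c
  ... | yes _  = subst (length (fibre c) ≤_) (sym (*-identityʳ _)) (≮⇒≥ (λ big′ → small (c , big′)))
  ... | no  ¬1 = ≤-trans (s≤s⁻¹ (≰⇒> ¬1)) z≤n
  |R|≤ : length R ≤ suc k ^ D * length C
  |R|≤ = begin
    length R                                                  ≤⟨ length≤∑-fibres hi R ⟩
    ∑ (allFin b) (λ c → length (fibre c))                     ≤⟨ ∑-mono (allFin b) fibre≤ ⟩
    ∑ (allFin b) (λ c → suc k ^ D * 𝟙 (nonempty? c))          ≡⟨ ∑-* (allFin b) (suc k ^ D) _ ⟩
    suc k ^ D * ∑ (allFin b) (λ c → 𝟙 (nonempty? c))
      ≡⟨ cong (suc k ^ D *_) (count≡length-filter nonempty? (allFin b)) ⟩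
    suc k ^ D * length C                                      ∎
  -- Every fibre has at most (k+1)^D elements, so more than (k+1)^(D+1) elements cannot be spread
  -- over `k` or fewer leading digits.
  k≤|C| : k ≤ length C
  k≤|C| = <⇒≤ (*-cancelˡ-< (suc k ^ D) k (length C) (begin-strict
    suc k ^ D * k      ≤⟨ *-monoʳ-≤ (suc k ^ D) (n≤1+n k) ⟩
    suc k ^ D * suc k  ≡⟨ *-comm (suc k ^ D) (suc k) ⟩
    suc k ^ suc D      <⟨ big ⟩
    length R           ≤⟨ |R|≤ ⟩
    suc k ^ D * length C ∎))
  pick : (xs : List X) → 0 < length xs → ∃[ x ] x ∈ xs
  pick (x ∷ _) _ = x , here refl
  branch : ∃[ r ] r ∈ R × ∃[ q ] ∀ i → ∃[ x ] x ∈ R × Block {b} {k} (suc D) q (f r) i (f x)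
  -- Any element can be `r`: no digit precedes the leading one, so nothing has to agree with it.
  branch with pick R (≤-trans z<s big)
            | increasing-choice k (AllPairs.filter⁺ nonempty? (allFin-sorted b)) k≤|C|
  ... | r , r∈ | v , incr , v∈ = r , r∈ , inj₁ v , hit
    where
    hit : ∀ i → ∃[ x ] x ∈ R × Increasing v × hi x ≡ lookup v i
    hit i with pick (fibre (lookup v i)) (proj₂ (∈-filter⁻ nonempty? {xs = allFin b} (v∈ i)))
    ... | x , x∈ with ∈-filter⁻ (λ x → hi x Fin.≟ lookup v i) {xs = R} x∈
    ...   | x∈R , qx = x , x∈R , incr , qx

-- Containment from a box of columns and an increasing sequence of row sets

AllPairs-resp-⊆ : {R : X → X → Set} {xs ys : List X} → xs ⊆ ys → AllPairs R ys → AllPairs R xs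
AllPairs-resp-⊆ []         []       = []
AllPairs-resp-⊆ (y ∷ʳ p)   (_ ∷ rs) = AllPairs-resp-⊆ p rs
AllPairs-resp-⊆ (refl ∷ p) (r ∷ rs) = All-resp-⊆ p r ∷ AllPairs-resp-⊆ p rs

take-drop-related : {R : X → X → Set} (m : ℕ) {xs : List X} → AllPairs R xs →
                    ∀ {x y} → x ∈ take m xs → y ∈ drop m xs → R x y
take-drop-related (suc m) (r ∷ rs) (here refl) y∈ = All.lookup r (⊆-lookup (drop-⊆ m _) y∈)
take-drop-related (suc m) (r ∷ rs) (there x∈)  y∈ = take-drop-related m rs x∈ y∈

chunks : ∀ t → ℕ → List X → Vec (List X) t
chunks zero    m xs = []
chunks (suc t) m xs = take m xs ∷ chunks t m (drop m xs)

length-chunks : ∀ t m (xs : List X) → t * m ≤ length xs →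
                VAll.All (λ C → length C ≡ m) (chunks t m xs)
length-chunks zero    m xs le = []
length-chunks (suc t) m xs le =
  trans (length-take m xs) (m≤n⇒m⊓n≡m (≤-trans (m≤m+n m (t * m)) le)) ∷
  length-chunks t m (drop m xs)
    (subst (t * m ≤_) (sym (length-drop m xs)) (m+n≤o⇒m≤o∸n (t * m) (subst (_≤ length xs) (+-comm m (t * m)) le)))

chunks-⊆ : ∀ t m (xs : List X) (p : Fin t) → lookup (chunks t m xs) p ⊆ xs
chunks-⊆ (suc t) m xs zero    = take-⊆ m xs
chunks-⊆ (suc t) m xs (suc p) = ⊆-trans (chunks-⊆ t m (drop m xs) p) (drop-⊆ m xs)

Separated : ∀ {n} → Vec (List (Fin n)) t → Set
Separated Xs =
  (∀ p → AllPairs Fin._<_ (lookup Xs p)) ×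
  (∀ {p q c d} → p Fin.< q → c ∈ lookup Xs p → d ∈ lookup Xs q → c Fin.< d)

chunks-separated : ∀ t m {n} {xs : List (Fin n)} → AllPairs Fin._<_ xs → Separated (chunks t m xs)
chunks-separated zero    m sorted = (λ ()) , λ { {()} }
chunks-separated (suc t) m {xs = xs} sorted = within , across
  where
  rest = chunks-separated t m (AllPairs.drop⁺ m sorted)
  within : ∀ p → AllPairs Fin._<_ (lookup (chunks (suc t) m xs) p)
  within zero    = AllPairs.take⁺ m sorted
  within (suc p) = proj₁ rest p
  across : ∀ {p q c d} → p Fin.< q → c ∈ lookup (chunks (suc t) m xs) p →
           d ∈ lookup (chunks (suc t) m xs) q → c Fin.< d
  across {zero}  {suc q} _   c∈ d∈ =
    take-drop-related m sorted c∈ (⊆-lookup (chunks-⊆ t m (drop m xs) q) d∈)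
  across {suc p} {suc q} p<q c∈ d∈ = proj₂ rest (s≤s⁻¹ p<q) c∈ d∈

Separated-resp-⊆ : ∀ {n} {Ss Xs : Vec (List (Fin n)) t} → Pointwise _⊆_ Ss Xs →
                   Separated Xs → Separated Ss
Separated-resp-⊆ Ss⊆ (sorted , cross) =
  (λ p → AllPairs-resp-⊆ (Pointwise.lookup Ss⊆ p) (sorted p)) ,
  λ {p} {q} p<q c∈ d∈ →
    cross p<q (⊆-lookup (Pointwise.lookup Ss⊆ p) c∈) (⊆-lookup (Pointwise.lookup Ss⊆ q) d∈)

Full : ∀ {m n} → Matrix m n → Fin m → Vec (Fin n) t → Set
Full M x T = ∀ p → entry M x (lookup T p) ≡ true

full? : ∀ {m n} (M : Matrix m n) x (T : Vec (Fin n) t) → Dec (Full M x T)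
full? M x T = Fin.all? λ p → entry M x (lookup T p) Bool.≟ true

-- The columns of A in piece p are sent into S_p; S_p has one more element than A has
-- columns, so that a row of A without a 1-entry in piece p can still be given one in S_p.
contains-from-box : ∀ {m n k l} (M : Matrix m n) (A : Matrix k l) → ColumnPartite t A →
  (Ss : Vec (List (Fin n)) t) → Separated Ss → VAll.All (λ S → length S ≡ suc l) Ss →
  (J : Fin k → Fin m → Set) → (∀ {i j x y} → i Fin.< j → J i x → J j y → x Fin.< y) →
  (∀ T → Pointwise _∈_ T Ss → ∀ i → ∃[ x ] J i x × Full M x T) → Contains M A
contains-from-box {t} {n = n} {k} {l} M A (piece , piece-mono , one-per-piece) Ss (sorted , cross) |Ss|
                  J J-mono hit =
  Vec.tabulate row , rows-increasing , Vec.tabulate col , cols-increasing , ones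
  where
  index : (p : Fin t) → Fin (suc l) → Fin (length (lookup Ss p))
  index p = Fin.cast (sym (VAll.lookup⁺ |Ss| p))
  at : Fin t → Fin (suc l) → Fin n
  at p j = List.lookup (lookup Ss p) (index p j)
  at∈ : ∀ p j → at p j ∈ lookup Ss p
  at∈ p j = ∈-lookup (index p j)
  at-mono : ∀ p {i j} → i Fin.< j → at p i Fin.< at p j
  at-mono p {i} {j} i<j = lookup-mono-< (sorted p)
    (subst₂ _<_ (sym (Fin.toℕ-cast _ i)) (sym (Fin.toℕ-cast _ j)) i<j)
  col : Fin l → Fin n
  col j = at (piece j) (inject₁ j)
  one? : ∀ i p → Dec (∃[ j ] piece j ≡ p × entry A i j ≡ true)
  one? i p = Fin.any? λ j → (piece j Fin.≟ p) ×-dec (entry A i j Bool.≟ true)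
  choice : Fin k → Fin t → Fin (suc l)
  choice i p with one? i p
  ... | yes (j , _) = inject₁ j
  ... | no _        = zero
  choice-one : ∀ i j → entry A i j ≡ true → choice i (piece j) ≡ inject₁ j
  choice-one i j one with one? i (piece j)
  ... | yes (j′ , eq , one′) = cong inject₁ (one-per-piece i j′ j eq one′ one)
  ... | no none              = contradiction (j , refl , one) none
  -- Tuple `T i` contains the images of all columns in which row `i` of `A` has a 1-entry, so a row
  -- of `M` full on it can play row `i`. The tuples differ from row to row, but all lie in the box,
  -- so the one family `J` supplies every row.
  T : Fin k → Vec (Fin n) t
  T i = Vec.tabulate λ p → at p (choice i p)
  lookup-T : ∀ i p → lookup (T i) p ≡ at p (choice i p)
  lookup-T i p = lookup∘tabulate _ p
  T∈ : ∀ i → Pointwise _∈_ (T i) Ss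
  T∈ i = extensional⇒inductive (ext λ p → subst (_∈ lookup Ss p) (sym (lookup-T i p)) (at∈ p _))
  row : Fin k → Fin _
  row i = proj₁ (hit (T i) (T∈ i) i)
  rows-increasing : Increasing (Vec.tabulate row)
  rows-increasing i j i<j rewrite lookup∘tabulate row i | lookup∘tabulate row j =
    J-mono i<j (proj₁ (proj₂ (hit (T i) (T∈ i) i))) (proj₁ (proj₂ (hit (T j) (T∈ j) j)))
  col-mono : ∀ i j → i Fin.< j → col i Fin.< col j
  col-mono i j i<j with piece i Fin.≟ piece j
  ... | yes eq = subst (λ p → at p (inject₁ i) Fin.< col j) (sym eq) (at-mono (piece j)
    (subst₂ _<_ (sym (Fin.toℕ-inject₁ i)) (sym (Fin.toℕ-inject₁ j)) i<j))
  ... | no neq = cross (Fin.≤∧≢⇒< (piece-mono (<⇒≤ i<j)) neq) (at∈ _ _) (at∈ _ _)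
  cols-increasing : Increasing (Vec.tabulate col)
  cols-increasing i j i<j rewrite lookup∘tabulate col i | lookup∘tabulate col j = col-mono i j i<j
  ones : ∀ i j → entry A i j ≡ true →
         entry M (lookup (Vec.tabulate row) i) (lookup (Vec.tabulate col) j) ≡ true
  ones i j one rewrite lookup∘tabulate row i | lookup∘tabulate col j =
    subst (λ c → entry M (row i) c ≡ true)
      (trans (lookup-T i (piece j)) (cong (at (piece j)) (choice-one i j one)))
      (proj₂ (proj₂ (hit (T i) (T∈ i) i)) (piece j))

-- Counting pairs of a row and a t-tuple of columns

∈-tuples⁻ : (Xs : Vec (List X) t) {T : Vec X t} → T ∈ tuples Xs → Pointwise _∈_ T Xs
∈-tuples⁻ []       {[]} _ = []
∈-tuples⁻ (X ∷ Xs) T∈ with a , v , a∈ , v∈ , refl ← ∈-cartesianProductWith⁻ _∷_ X (tuples Xs) T∈ =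
  a∈ ∷ ∈-tuples⁻ Xs v∈

ones : ∀ {m n} → Matrix m n → Fin m → List (Fin n)
ones {n = n} M r = filter (λ c → entry M r c Bool.≟ true) (allFin n)

-- Stated for `tabulate g` so that the induction closes: the tail of `allFin` is a tabulation of
-- `suc`.
count-true : ∀ {n} (row : Vec Bool n) {X : Set} (g : Fin n → X) (f : X → Bool) →
             (∀ c → f (g c) ≡ lookup row c) →
             Vec.count (Bool._≟ true) row ≡ length (filter (λ x → f x Bool.≟ true) (tabulate g))
count-true []          g f eq = refl
count-true (true ∷ row) g f eq rewrite eq zero = cong suc (count-true row (g ∘ suc) f (eq ∘ suc))
count-true (false ∷ row) g f eq rewrite eq zero = count-true row (g ∘ suc) f (eq ∘ suc)

∑-tabulate : ∀ {n} (g : Fin n → X) (f : X → ℕ) → ∑ (tabulate g) f ≡ ∑ (allFin n) (f ∘ g)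
∑-tabulate {n = zero}  g f = refl
∑-tabulate {n = suc n} g f =
  cong (f (g zero) +_) (trans (∑-tabulate (g ∘ suc) f) (sym (∑-tabulate suc (f ∘ g))))

weight≡∑-ones : ∀ {m n} (M : Matrix m n) → weight M ≡ ∑ (allFin m) (λ r → length (ones M r))
weight≡∑-ones []        = refl
weight≡∑-ones (row ∷ M) = cong₂ _+_ (count-true row id (lookup row) (λ _ → refl))
  (trans (weight≡∑-ones M) (sym (∑-tabulate suc (λ r → length (ones (row ∷ M) r)))))

module _ {n k l : ℕ} (M : Matrix n n) (A : Matrix k l) (b D : ℕ) (n≤b^D : n ≤ b ^ D) where

  private
    digits : Fin n → Fin (b ^ D)
    digits r = inject≤ r n≤b^D

    B : ℕ
    B = suc k ^ D

    cs : List (Code b k D)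
    cs = codes b k D

  -- For fixed `q` and `r` this is the edge relation of the hypergraph in which a complete box is
  -- sought.
  Linked : Code b k D → Fin n → Vec (Fin n) t → Set
  Linked q r T = ∀ i → ∃[ x ] Block D q (digits r) i (digits x) × Full M x T

  linked? : ∀ q r (T : Vec (Fin n) t) → Dec (Linked q r T)
  linked? q r T = Fin.all? λ i → Fin.any? λ x → block? D q (digits r) i (digits x) ×-dec full? M x T

  Charged : Fin n → Vec (Fin n) t → Set
  Charged r T = Any (λ q → Linked q r T) cs

  charged? : ∀ r (T : Vec (Fin n) t) → Dec (Charged r T)
  charged? r T = any? (λ q → linked? q r T) cs

  uncharged? : ∀ r (T : Vec (Fin n) t) → Dec (Full M r T × ¬ Charged r T)
  uncharged? r T = full? M r T ×-dec ¬? (charged? r T)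

  -- Among more than `B` such rows, `separation` would find a row r and a code each of whose blocks
  -- relative to r contains one of them. These rows are full on `T`, so the code would charge r.
  few-uncharged : (T : Vec (Fin n) t) → ∑ (allFin n) (λ r → 𝟙 (uncharged? r T)) ≤ B
  few-uncharged T = ≮⇒≥ λ big →
    let r , r∈ , q , hits = separation b k D digits R (Unique.filter⁺ u? (Unique.allFin⁺ n))
                              (λ _ _ → Fin.inject≤-injective n≤b^D n≤b^D _ _)
                              (subst (B <_) (count≡length-filter u? (allFin n)) big)
        _ , _ , ¬charged = unfilter r∈
    in ¬charged (lose (∈-codes D q) λ i →
         let x , x∈ , blk = hits i
             _ , fullx , _ = unfilter x∈
         in x , blk , fullx)
    where
    u? = λ r → uncharged? r T
    R = filter u? (allFin n)
    unfilter : ∀ {x} → x ∈ R → x ∈ allFin n × Full M x T × ¬ Charged x T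
    unfilter = ∈-filter⁻ u? {xs = allFin n}

  -- Otherwise a single code links more than a 1/(2|cs|) fraction of the tuples, which is at least
  -- 1/s. `complete-box` then yields a box of columns, and the blocks of that code supply the
  -- increasing rows of a copy of `A`.
  few-charged : ColumnPartite t A → ¬ Contains M A →
    ∀ s m → 8 * suc l ≤ s → s ^ ((2 * suc (suc l)) ^ t) ≤ m → 2 * length cs ≤ s →
    (r : Fin n) (Xs : Vec (List (Fin n)) t) → Separated Xs → VAll.All (λ X → length X ≡ m) Xs →
    2 * ∑ (tuples Xs) (λ T → 𝟙 (charged? r T)) ≤ m ^ t
  few-charged {t} part avoids s m 8L≤s s≤m 2|cs|≤s r Xs sep |Xs| = ≮⇒≥ λ big →
    from-pigeonhole big (pigeonhole cs f
      (*-cancelˡ-< 2 0 (∑ cs f) (≤-<-trans z≤n (<-≤-trans big (*-monoʳ-≤ 2 charged≤)))))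
    where
    open ≤-Reasoning
    f : Code b k D → ℕ
    f q = ∑ (tuples Xs) (λ T → 𝟙 (linked? q r T))
    charged≤ : ∑ (tuples Xs) (λ T → 𝟙 (charged? r T)) ≤ ∑ cs f
    charged≤ = begin
      ∑ (tuples Xs) (λ T → 𝟙 (charged? r T))
        ≤⟨ ∑-mono (tuples Xs) (λ T → 𝟙-≤ (charged? r T) λ linked →
             let q , q∈ , lk = find linked
             in ≤-trans (𝟙-true (linked? q r T) lk) (∑-≥ (λ q → 𝟙 (linked? q r T)) q∈)) ⟩
      ∑ (tuples Xs) (λ T → ∑ cs (λ q → 𝟙 (linked? q r T)))  ≡⟨ ∑-swap (tuples Xs) cs _ ⟩
      ∑ cs f  ∎
    from-pigeonhole : m ^ t < 2 * ∑ (tuples Xs) (λ T → 𝟙 (charged? r T)) →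
                      ¬ (∃[ q ] q ∈ cs × ∑ cs f ≤ length cs * f q)
    from-pigeonhole big (q , _ , le) =
      let Ss , Ss⊆ , |Ss| , box = complete-box (suc l) s m 8L≤s s≤m Xs |Xs| (linked? q r) dense
      in avoids (contains-from-box M A part Ss (Separated-resp-⊆ Ss⊆ sep) |Ss|
           (λ i x → Block D q (digits r) i (digits x))
           (λ {_} {_} {x} {y} i<j blk blk′ → subst₂ _<_ (Fin.toℕ-inject≤ x n≤b^D) (Fin.toℕ-inject≤ y n≤b^D)
             (block-mono D q (digits r) i<j blk blk′))
           box)
      where
      dense : m ^ t ≤ s * f q
      dense = begin
        m ^ t                                        ≤⟨ <⇒≤ big ⟩
        2 * ∑ (tuples Xs) (λ T → 𝟙 (charged? r T))   ≤⟨ *-monoʳ-≤ 2 (≤-trans charged≤ le) ⟩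
        2 * (length cs * f q)                        ≡⟨ *-assoc 2 (length cs) (f q) ⟨
        2 * length cs * f q                          ≤⟨ *-monoˡ-≤ (f q) 2|cs|≤s ⟩
        s * f q                                      ∎

  columnTuples : ∀ t → List (Vec (Fin n) t)
  columnTuples t = tuples (replicate t (allFin n))

  uncharged : ∀ t → Fin n → ℕ
  uncharged t r = ∑ (columnTuples t) (λ T → 𝟙 (uncharged? r T))

  ∑-uncharged : ∀ t → ∑ (allFin n) (uncharged t) ≤ n ^ t * B
  ∑-uncharged t = begin
    ∑ (allFin n) (uncharged t)
      ≡⟨ ∑-swap (allFin n) (columnTuples t) _ ⟩
    ∑ (columnTuples t) (λ T → ∑ (allFin n) (λ r → 𝟙 (uncharged? r T)))
      ≤⟨ ∑-mono (columnTuples t) few-uncharged ⟩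
    ∑ (columnTuples t) (λ _ → B)
      ≡⟨ ∑-const (columnTuples t) B ⟩
    length (columnTuples t) * B
      ≡⟨ cong (_* B) (length-tuples {Xs = replicate t (allFin n)} (VAll.lookup⁻ λ p →
           trans (cong length (lookup-replicate p (allFin n))) (length-tabulate {n = n} id))) ⟩
    n ^ t * B ∎
    where open ≤-Reasoning

  -- Row `r` is full on each of the `m ^ t` tuples taken from consecutive chunks of its ones, and at
  -- most half of these are charged. The others are counted among all column tuples, a range
  -- independent of `r`, to allow summation over rows.
  many-uncharged : ColumnPartite t A → ¬ Contains M A →
    ∀ s m → 8 * suc l ≤ s → s ^ ((2 * suc (suc l)) ^ t) ≤ m → 2 * length cs ≤ s →
    (r : Fin n) → t * m ≤ length (ones M r) → m ^ t ≤ 2 * uncharged t r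
  many-uncharged {t} part avoids s m 8L≤s s≤m 2|cs|≤s r tm≤ = +-cancelˡ-≤ (m ^ t) _ _ (begin
    m ^ t + m ^ t       ≡⟨ cong (m ^ t +_) (+-identityʳ (m ^ t)) ⟨
    2 * m ^ t           ≡⟨ cong (2 *_) (trans (sym (*-identityʳ (m ^ t))) (cong (_* 1) (sym (length-tuples |Xs|)))) ⟩
    2 * (length (tuples Xs) * 1)  ≡⟨ cong (2 *_) (∑-const (tuples Xs) 1) ⟨
    2 * ∑ (tuples Xs) (λ _ → 1)   ≤⟨ *-monoʳ-≤ 2 (∑-mono-∈ (tuples Xs) charged-or-not) ⟩
    2 * ∑ (tuples Xs) (λ T → 𝟙 (charged? r T) + 𝟙 (uncharged? r T))
      ≡⟨ cong (2 *_) (∑-+ (tuples Xs) _ _) ⟩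
    2 * (∑ (tuples Xs) (λ T → 𝟙 (charged? r T)) + ∑ (tuples Xs) (λ T → 𝟙 (uncharged? r T)))
      ≡⟨ *-distribˡ-+ 2 (∑ (tuples Xs) (λ T → 𝟙 (charged? r T))) _ ⟩
    2 * ∑ (tuples Xs) (λ T → 𝟙 (charged? r T)) + 2 * ∑ (tuples Xs) (λ T → 𝟙 (uncharged? r T))
      ≤⟨ +-mono-≤
           (few-charged part avoids s m 8L≤s s≤m 2|cs|≤s r Xs (chunks-separated t m sorted) |Xs|)
           (*-monoʳ-≤ 2 (∑-tuples-⊆ _ Xs⊆)) ⟩
    m ^ t + 2 * uncharged t r ∎)
    where
    open ≤-Reasoning
    one? = λ c → entry M r c Bool.≟ true
    Xs = chunks t m (ones M r)
    |Xs| = length-chunks t m (ones M r) tm≤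
    sorted : AllPairs Fin._<_ (ones M r)
    sorted = AllPairs.filter⁺ one? (allFin-sorted n)
    Xs⊆ : Pointwise _⊆_ Xs (replicate t (allFin n))
    Xs⊆ = extensional⇒inductive (ext λ p → subst (lookup Xs p ⊆_) (sym (lookup-replicate p (allFin n)))
      (⊆-trans (chunks-⊆ t m (ones M r) p) (filter-⊆ one? (allFin n))))
    charged-or-not : ∀ {T} → T ∈ tuples Xs → 1 ≤ 𝟙 (charged? r T) + 𝟙 (uncharged? r T)
    charged-or-not {T} T∈ = split (charged? r T)
      where
      row-full : Full M r T
      row-full p = proj₂ (∈-filter⁻ one? {xs = allFin n}
        (⊆-lookup (chunks-⊆ t m (ones M r) p) (Pointwise.lookup (∈-tuples⁻ Xs T∈) p)))
      split : Dec (Charged r T) → 1 ≤ 𝟙 (charged? r T) + 𝟙 (uncharged? r T)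
      split (yes c) = ≤-trans (𝟙-true (charged? r T) c) (m≤m+n _ _)
      split (no ¬c) = ≤-trans (𝟙-true (uncharged? r T) (row-full , ¬c)) (m≤n+m _ (𝟙 (charged? r T)))

-- Here `m` is a threshold for the group size of a row: smaller groups are cheap, and for larger
-- ones `many-uncharged` applies. Double counting bounds all uncharged pairs by n^(t+1)(k+1)^D, and
-- `tuples≤` makes twice this at most n·m^(t+1).
weight-bound : ∀ {n k l} t (M : Matrix n n) (A : Matrix k l) →
  ColumnPartite (suc t) A → ¬ Contains M A →
  ∀ b D s m .{{_ : NonZero m}} → n ≤ b ^ D → 2 * (D * b ^ k) ≤ s → 8 * suc l ≤ s →
  s ^ ((2 * suc (suc l)) ^ suc t) ≤ m → 2 * suc k ^ D * n ^ t ≤ m ^ suc t →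
  weight M ≤ 3 * suc t * m * n
weight-bound {n} {k} {l} t M A part avoids b D s m n≤b^D codes≤s 8L≤s s≤m tuples≤ = begin
  weight M                                    ≡⟨ weight≡∑-ones M ⟩
  ∑ (allFin n) (λ r → length (ones M r))      ≤⟨ ∑-mono (allFin n) length≤ ⟩
  ∑ (allFin n) (λ r → suc t + suc t * μ r)    ≡⟨ ∑-+ (allFin n) _ _ ⟩
  ∑ (allFin n) (λ _ → suc t) + ∑ (allFin n) (λ r → suc t * μ r)
    ≡⟨ cong₂ _+_ (trans (∑-const (allFin n) (suc t)) (cong (_* suc t) |allFin|)) (∑-* (allFin n) (suc t) μ) ⟩
  n * suc t + suc t * ∑ (allFin n) μ
    ≤⟨ +-mono-≤ (*-monoʳ-≤ n (m≤m*n (suc t) m)) (*-monoʳ-≤ (suc t) ∑μ≤) ⟩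
  n * (suc t * m) + suc t * (2 * n * m)       ≡⟨ lem₃ n (suc t) m ⟩
  3 * suc t * m * n                           ∎
  where
  open ≤-Reasoning
  lem₁ : ∀ n a m B N → n * (a * m) + 2 * (n * N * B) ≡ n * (a * m) + n * (2 * B * N)
  lem₁ = solve-∀
  lem₂ : ∀ n a m → n * (m * a) + n * (m * a) ≡ 2 * n * m * a
  lem₂ = solve-∀
  lem₃ : ∀ n t m → n * (t * m) + t * (2 * n * m) ≡ 3 * t * m * n
  lem₃ = solve-∀
  instance
    m^t≢0 : NonZero (m ^ t)
    m^t≢0 = m^n≢0 m t
  |allFin| : length (allFin n) ≡ n
  |allFin| = length-tabulate {n = n} id
  U : Fin n → ℕ
  U = uncharged M A b D n≤b^D (suc t)
  μ : Fin n → ℕ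
  μ r = length (ones M r) / suc t
  -- Rounding down to equal groups loses less than `suc t` ones per row; as `m` is nonzero, the
  -- total loss is at most n(t+1)m.
  length≤ : ∀ r → length (ones M r) ≤ suc t + suc t * μ r
  length≤ r = begin
    length (ones M r)  ≡⟨ m≡m%n+[m/n]*n (length (ones M r)) (suc t) ⟩
    length (ones M r) % suc t + μ r * suc t
      ≤⟨ +-mono-≤ (<⇒≤ (m%n<n (length (ones M r)) (suc t))) (≤-reflexive (*-comm (μ r) (suc t))) ⟩
    suc t + suc t * μ r ∎
  -- Above the threshold, μ^(t+1) is at least m^t·μ. This bound is linear in μ, so the rows can be
  -- summed without a convexity inequality.
  row-bound : ∀ r → m ^ t * μ r ≤ m ^ suc t + 2 * U r
  row-bound r with ≤-total (μ r) m
  ... | inj₁ μ≤m = ≤-trans (≤-trans (*-monoʳ-≤ (m ^ t) μ≤m) (≤-reflexive (*-comm (m ^ t) m))) (m≤m+n (m ^ suc t) _)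
  ... | inj₂ m≤μ = begin
    m ^ t * μ r          ≤⟨ *-monoˡ-≤ (μ r) (^-monoˡ-≤ t m≤μ) ⟩
    μ r ^ t * μ r        ≡⟨ *-comm (μ r ^ t) (μ r) ⟩
    μ r ^ suc t          ≤⟨ many-uncharged M A b D n≤b^D part avoids s (μ r) 8L≤s (≤-trans s≤m m≤μ)
                              (subst (λ c → 2 * c ≤ s) (sym (length-codes b k D)) codes≤s) r
                              (subst (_≤ length (ones M r)) (*-comm (μ r) (suc t)) (m/n*n≤m _ (suc t))) ⟩
    2 * U r              ≤⟨ m≤n+m _ (m ^ suc t) ⟩
    m ^ suc t + 2 * U r  ∎
  ∑μ≤ : ∑ (allFin n) μ ≤ 2 * n * m
  ∑μ≤ = *-cancelʳ-≤ _ _ (m ^ t) (begin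
    ∑ (allFin n) μ * m ^ t                     ≡⟨ *-comm _ (m ^ t) ⟩
    m ^ t * ∑ (allFin n) μ                     ≡⟨ ∑-* (allFin n) (m ^ t) μ ⟨
    ∑ (allFin n) (λ r → m ^ t * μ r)           ≤⟨ ∑-mono (allFin n) row-bound ⟩
    ∑ (allFin n) (λ r → m ^ suc t + 2 * U r)   ≡⟨ ∑-+ (allFin n) _ _ ⟩
    ∑ (allFin n) (λ _ → m ^ suc t) + ∑ (allFin n) (λ r → 2 * U r)
      ≡⟨ cong₂ _+_ (trans (∑-const (allFin n) (m ^ suc t)) (cong (_* m ^ suc t) |allFin|)) (∑-* (allFin n) 2 U) ⟩
    n * m ^ suc t + 2 * ∑ (allFin n) U
      ≤⟨ +-monoʳ-≤ (n * m ^ suc t) (*-monoʳ-≤ 2 (∑-uncharged M A b D n≤b^D (suc t))) ⟩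
    n * (m * m ^ t) + 2 * (n * n ^ t * suc k ^ D)  ≡⟨ lem₁ n m (m ^ t) (suc k ^ D) (n ^ t) ⟩
    n * (m * m ^ t) + n * (2 * suc k ^ D * n ^ t)  ≤⟨ +-monoʳ-≤ (n * m ^ suc t) (*-monoʳ-≤ n tuples≤) ⟩
    n * (m * m ^ t) + n * (m * m ^ t)          ≡⟨ lem₂ n (m ^ t) m ⟩
    2 * n * m * m ^ t                          ∎)

-- The choice of the parameters

integer-root : ∀ q .{{_ : NonZero q}} N → ∃[ x ] x ^ q ≤ N × N < suc x ^ q
integer-root (suc q) zero    = 0 , z≤n , m^n>0 1 (suc q)
integer-root (suc q) (suc N) with integer-root (suc q) N
... | x , x^q≤N , N<sx^q with suc x ^ suc q ≤? suc N
...   | yes sx^q≤ = suc x , sx^q≤ , ≤-<-trans N<sx^q (^-monoˡ-< (suc q) (n<1+n (suc x)))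
...   | no  sx^q≰ = x , m≤n⇒m≤1+n x^q≤N , ≰⇒> sx^q≰

^-distribʳ-* : ∀ o m n → (m * n) ^ o ≡ m ^ o * n ^ o
^-distribʳ-* zero    m n = refl
^-distribʳ-* (suc o) m n = trans (cong (m * n *_) (^-distribʳ-* o m n)) (lem m n (m ^ o) (n ^ o))
  where
  lem : ∀ m n a b → m * n * (a * b) ≡ m * a * (n * b)
  lem = solve-∀

-- Here `m` is the integer part of the root of c·n^t. It is not 0 because c·n^t is at least 1, so
-- `suc m` is at most 2m, which turns the factor 3 into 6. The powers of `n` combine to t + (t+1) =
-- 2(t+1) - 1.
root-bound : ∀ t m n c .{{_ : NonZero n}} .{{_ : NonZero c}} →
  m ^ suc t ≤ c * n ^ t → c * n ^ t < suc m ^ suc t →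
  (3 * suc t * suc m * n) ^ suc t ≤ (6 * suc t * c) ^ suc t * n ^ (2 * suc t ∸ 1)
root-bound t zero n c _ <sm = contradiction
  (subst (c * n ^ t <_) (^-zeroˡ (suc t)) <sm)
  (≤⇒≯ (*-mono-≤ (>-nonZero⁻¹ c) (m^n>0 n t)))
root-bound t m@(suc _) n c m≤ _ = begin
  (3 * suc t * suc m * n) ^ suc t
    ≤⟨ ^-monoˡ-≤ (suc t) (*-monoˡ-≤ n (*-monoʳ-≤ (3 * suc t) sm≤2m)) ⟩
  (3 * suc t * (2 * m) * n) ^ suc t             ≡⟨ cong (_^ suc t) (lem₁ (suc t) m n) ⟩
  (6 * suc t * (m * n)) ^ suc t                 ≡⟨ ^-distribʳ-* (suc t) (6 * suc t) (m * n) ⟩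
  (6 * suc t) ^ suc t * (m * n) ^ suc t         ≡⟨ cong ((6 * suc t) ^ suc t *_) (^-distribʳ-* (suc t) m n) ⟩
  (6 * suc t) ^ suc t * (m ^ suc t * n ^ suc t)
    ≤⟨ *-monoʳ-≤ ((6 * suc t) ^ suc t) (*-monoˡ-≤ (n ^ suc t)
         (≤-trans m≤ (*-monoˡ-≤ (n ^ t) (m≤m*n c (c ^ t) {{m^n≢0 c t}})))) ⟩
  (6 * suc t) ^ suc t * (c ^ suc t * n ^ t * n ^ suc t)
    ≡⟨ lem₂ ((6 * suc t) ^ suc t) (c ^ suc t) (n ^ t) (n ^ suc t) ⟩
  (6 * suc t) ^ suc t * c ^ suc t * (n ^ t * n ^ suc t)
    ≡⟨ cong₂ _*_ (sym (^-distribʳ-* (suc t) (6 * suc t) c)) (sym (^-distribˡ-+-* n t (suc t))) ⟩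
  (6 * suc t * c) ^ suc t * n ^ (t + suc t)
    ≡⟨ cong (λ e → (6 * suc t * c) ^ suc t * n ^ (t + e)) (+-identityʳ (suc t)) ⟨
  (6 * suc t * c) ^ suc t * n ^ (2 * suc t ∸ 1) ∎
  where
  open ≤-Reasoning
  sm≤2m : suc m ≤ 2 * m
  sm≤2m = subst (suc m ≤_) (cong (m +_) (sym (+-identityʳ m))) (+-monoˡ-≤ m {1} (s≤s z≤n))
  lem₁ : ∀ t m n → 3 * t * (2 * m) * n ≡ 6 * t * (m * n)
  lem₁ = solve-∀
  lem₂ : ∀ a b c d → a * (b * c * d) ≡ a * b * (c * d)
  lem₂ = solve-∀

square-cancel-≤ : ∀ {x y} → x * x ≤ y * y → x ≤ y
square-cancel-≤ le = ≮⇒≥ λ y<x → <⇒≱ (*-mono-< y<x y<x) le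

-- This is where having at least two pieces enters: n^(t/(t+1)) is then at least the square root of
-- `n`, so `m` can exceed a fixed power of the digit base.
n≤m² : ∀ t m n .{{_ : NonZero n}} → 1 ≤ t → n ^ t ≤ m ^ suc t → n ≤ m * m
n≤m² t m n 1≤t n^t≤ = ≮⇒≥ λ m²<n → <⇒≱ (^-monoˡ-< (suc t) m²<n) (begin
  n ^ suc t              ≤⟨ ^-monoʳ-≤ n (+-monoˡ-≤ t 1≤t) ⟩
  n ^ (t + t)            ≡⟨ ^-distribˡ-+-* n t t ⟩
  n ^ t * n ^ t          ≤⟨ *-mono-≤ n^t≤ n^t≤ ⟩
  m ^ suc t * m ^ suc t  ≡⟨ ^-distribʳ-* (suc t) m m ⟨
  (m * m) ^ suc t        ∎)
  where open ≤-Reasoning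

ex-≤ : ∀ {k l} n (A : Matrix k l) {w} → ((M : Matrix n n) → ¬ Contains M A → weight M ≤ w) → ex n A ≤ w
ex-≤ n A bound = max≤v⁺ z≤n (map⁺ (All.tabulate λ {M} M∈ →
  bound M (proj₂ (∈-filter⁻ (λ M → ¬? (contains? M A)) {xs = allMatrices n n} M∈))))

theorem1p5 : (t : ℕ) → 2 ≤ t → ∀ {k l} (A : Matrix k l) → ColumnPartite t A →
    (λ n → ex n A) isO[n^ 2 * t ∸ 1 / t ]
theorem1p5 (suc t) 2≤t {k} {l} A part = 6 * suc t * c , c₀ ^ D , bound
  where
  open ≤-Reasoning
  e g D c c₀ : ℕ
  -- The exponent that `complete-box` demands for boxes of side `suc l`. With s = (b+1)^(k+1), its
  -- condition becomes (b+1)^g ≤ m+1.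
  e  = (2 * suc (suc l)) ^ suc t
  g  = suc k * e
  -- One factor 2 pays for b+1 ≤ b², the other for the square root: (b+1)^g is at most b^(2g), whose
  -- square b^D is at most n.
  D  = 2 * g * 2
  -- The coefficient in the condition on `n ^ t` in `weight-bound`.
  c  = 2 * suc k ^ D
  -- For n at least c₀^D the base satisfies c₀ ≤ b, so b dominates both `2 * D` and `8 * suc l`.
  c₀ = 2 * D + 8 * suc l
  instance
    e≢0 : NonZero e
    e≢0 = m^n≢0 (2 * suc (suc l)) (suc t)
    g≢0 : NonZero g
    g≢0 = m*n≢0 (suc k) e
    2g≢0 : NonZero (2 * g)
    2g≢0 = m*n≢0 2 g
    D≢0 : NonZero D
    D≢0 = m*n≢0 (2 * g) 2
    k^D≢0 : NonZero (suc k ^ D)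
    k^D≢0 = m^n≢0 (suc k) D
    c≢0 : NonZero c
    c≢0 = m*n≢0 2 (suc k ^ D)
  8≤c₀ : 8 ≤ c₀
  8≤c₀ = ≤-trans (m≤m*n 8 (suc l)) (m≤n+m _ (2 * D))
  instance
    c₀≢0 : NonZero c₀
    c₀≢0 = >-nonZero (≤-trans (s≤s z≤n) 8≤c₀)
  bound : ∀ n → c₀ ^ D ≤ n → ex n A ^ suc t ≤ (6 * suc t * c) ^ suc t * n ^ (2 * suc t ∸ 1)
  -- Both roots are rounded down, so `suc b` and `suc m` are passed on: D digits in base b+1 suffice
  -- for n rows, and (m+1)^(t+1) exceeds c·n^t.
  bound n N≤n with b , b^D≤n , n<sb^D ← integer-root D n | m , m≤ , <sm ← integer-root (suc t) (c * n ^ t) =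
    ≤-trans (^-monoˡ-≤ (suc t) (ex-≤ n A λ M avoids →
      -- There are D(b+1)^k codes; the further factor b+1 in s absorbs 2D.
      weight-bound t M A part avoids (suc b) D (suc b ^ suc k) (suc m)
        (<⇒≤ n<sb^D) codes≤ 8L≤ s≤sm (<⇒≤ <sm)))
      (root-bound t m n c m≤ <sm)
    where
    instance
      n≢0 : NonZero n
      n≢0 = >-nonZero (≤-trans (m^n>0 c₀ D) N≤n)
    c₀≤b : c₀ ≤ b
    c₀≤b = s≤s⁻¹ (≰⇒> λ sb≤c₀ → <⇒≱ n<sb^D (≤-trans (^-monoˡ-≤ D sb≤c₀) N≤n))
    codes≤ : 2 * (D * suc b ^ k) ≤ suc b ^ suc k
    codes≤ = ≤-trans (≤-reflexive (sym (*-assoc 2 D (suc b ^ k))))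
      (*-monoˡ-≤ (suc b ^ k) (≤-trans (m≤m+n (2 * D) _) (m≤n⇒m≤1+n c₀≤b)))
    8L≤ : 8 * suc l ≤ suc b ^ suc k
    8L≤ = ≤-trans (≤-trans (m≤n+m _ (2 * D)) (m≤n⇒m≤1+n c₀≤b))
      (m≤m*n (suc b) (suc b ^ k) {{m^n≢0 (suc b) k}})
    sb≤b² : suc b ≤ b ^ 2
    sb≤b² = begin
      suc b  ≤⟨ +-monoˡ-≤ b {1} (≤-trans (s≤s z≤n) (≤-trans 8≤c₀ c₀≤b)) ⟩
      b + b  ≡⟨ cong (b +_) (+-identityʳ b) ⟨
      2 * b  ≤⟨ *-monoˡ-≤ b {2} (≤-trans (s≤s (s≤s z≤n)) (≤-trans 8≤c₀ c₀≤b)) ⟩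
      b * b  ≡⟨ cong (b *_) (*-identityʳ b) ⟨
      b ^ 2  ∎
    n≤sm² : n ≤ suc m * suc m
    n≤sm² = n≤m² t (suc m) n (s≤s⁻¹ 2≤t) (≤-trans (m≤n*m (n ^ t) c) (<⇒≤ <sm))
    s≤sm : (suc b ^ suc k) ^ e ≤ suc m
    s≤sm = begin
      (suc b ^ suc k) ^ e  ≡⟨ ^-*-assoc (suc b) (suc k) e ⟩
      suc b ^ g            ≤⟨ ^-monoˡ-≤ g sb≤b² ⟩
      (b ^ 2) ^ g          ≡⟨ ^-*-assoc b 2 g ⟩
      b ^ (2 * g)          ≤⟨ square-cancel-≤ (begin
        b ^ (2 * g) * b ^ (2 * g)  ≡⟨ cong (b ^ (2 * g) *_) (*-identityʳ _) ⟨
        (b ^ (2 * g)) ^ 2          ≡⟨ ^-*-assoc b (2 * g) 2 ⟩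
        b ^ D                      ≤⟨ b^D≤n ⟩
        n                          ≤⟨ n≤sm² ⟩
        suc m * suc m              ∎) ⟩
      suc m                ∎
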